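{- Let $\mathbf{D}_{\mathrm{surj}}$ be the category whose objects are finite distributive lattices and whose morphisms are surjective lattice homomorphisms. Then $\mathbf{D}_{\mathrm{surj}}$ does not have the dual Ramsey property for objects.
   Context: Lattices are considered with bottom $0$ and top $1$ in the signature (so homomorphisms preserve $0$ and $1$; for surjective homomorphisms this is automatic). For a category $\mathbf{C}$ and objects $\mathcal{A},\mathcal{B}$, define $\sim_{\mathcal{A}}$ on $\hom_{\mathbf{C}}(\mathcal{A},\mathcal{B})$ by: $f\sim_{\mathcal{A}} f'$ iff $f'=f\cdot\alpha$ for some invertible morphism $\alpha\in\hom_{\mathbf{C}}(\mathcal{A},\mathcal{A})$. Put $\binom{\mathcal{B}}{\mathcal{A}}_{\mathbf{C}}=\hom_{\mathbf{C}}(\mathcal{A},\mathcal{B})/\!\sim_{\mathcal{A}}$; for $w\in\hom_{\mathbf{C}}(\mathcal{B},\mathcal{C})$ put $w\cdot(f/\!\sim_{\mathcal{A}})=(w\cdot f)/\!\sim_{\mathcal{A}}$. A $k$-coloring of a set $\mathcal{S}$ is a decomposition $\mathcal{S}=\mathcal{M}_1\cup\dots\cup\mathcal{M}_k$ with $\mathcal{M}_i\cap\mathcal{M}_j=\varnothing$ for $i\neq j$ (blocks may be empty). The category $\mathbf{C}$ has the Ramsey property for objects if for every integer $k\ge 2$ and all objects $\mathcal{A},\mathcal{B}$ with $\hom_{\mathbf{C}}(\mathcal{A},\mathcal{B})\ne\varnothing$ there is an object $\mathcal{C}$ such that for every $k$-coloring $\binom{\mathcal{C}}{\mathcal{A}}_{\mathbf{C}}=\mathcal{M}_1\cup\dots\cup\mathcal{M}_k$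 there are $i$ and $w\in\hom_{\mathbf{C}}(\mathcal{B},\mathcal{C})$ with $w\cdot\binom{\mathcal{B}}{\mathcal{A}}_{\mathbf{C}}\subseteq\mathcal{M}_i$. The category $\mathbf{C}$ has the dual Ramsey property for objects if the opposite category $\mathbf{C}^{\mathrm{op}}$ has the Ramsey property for objects. -}

module Defs where

open import Level using (Level; _⊔_; suc; 0ℓ)
open import Data.Nat.Base using (ℕ; _≤_)
open import Data.Fin.Base using (Fin)
open import Data.Product.Base using (Σ; ∃; ∃-syntax; _×_; _,_)
import Function.Base as Fun
open import Function.Bundles using (Func; Inverse)
open import Function.Definitions using (Surjective)
import Function.Construct.Composition as Composition
import Function.Construct.Identity as Identity
open import Relation.Binary.Bundles using (Setoid)
open import Relation.Binary.Core using (Rel)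
open import Relation.Binary.Definitions using (_Respects_)
open import Relation.Binary.Structures using (IsEquivalence)
open import Relation.Binary.PropositionalEquality as ≡ using (_≢_)
open import Relation.Unary using (Pred; _∈_; _∩_; ⋃; Universal; Empty)
open import Algebra.Definitions using (Identity)
open import Algebra.Lattice.Bundles using (DistributiveLattice)
open import Algebra.Lattice.Morphism.Structures using (IsLatticeHomomorphism)
import Algebra.Lattice.Morphism.Construct.Composition as LatComposition
import Algebra.Lattice.Morphism.Construct.Identity as LatIdentity

-- Hom-sets are setoids: _≈_ is the equality of parallel morphisms.

record Category (o ℓ e : Level) : Set (suc (o ⊔ ℓ ⊔ e)) where
  infix  4 _≈_ _⇒_
  infixr 9 _·_
  field
    Obj           : Set o
    _⇒_           : Rel Obj ℓ
    _≈_           : ∀ {A B} → Rel (A ⇒ B) e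
    id            : ∀ {A} → A ⇒ A
    _·_           : ∀ {A B C} → B ⇒ C → A ⇒ B → A ⇒ C
    isEquivalence : ∀ {A B} → IsEquivalence (_≈_ {A} {B})
    ·-cong        : ∀ {A B C} {f f′ : B ⇒ C} {g g′ : A ⇒ B} →
                    f ≈ f′ → g ≈ g′ → f · g ≈ f′ · g′
    assoc         : ∀ {A B C D} (f : C ⇒ D) (g : B ⇒ C) (h : A ⇒ B) →
                    (f · g) · h ≈ f · (g · h)
    identityˡ     : ∀ {A B} (f : A ⇒ B) → id · f ≈ f
    identityʳ     : ∀ {A B} (f : A ⇒ B) → f · id ≈ f

  module ≈ {A B} = IsEquivalence (isEquivalence {A} {B})

opposite : ∀ {o ℓ e} → Category o ℓ e → Category o ℓ e
opposite C = record
  { Obj           = Obj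
  ; _⇒_           = λ A B → B ⇒ A
  ; _≈_           = _≈_
  ; id            = id
  ; _·_           = λ f g → g · f
  ; isEquivalence = isEquivalence
  ; ·-cong        = λ p q → ·-cong q p
  ; assoc         = λ f g h → ≈.sym (assoc h g f)
  ; identityˡ     = identityʳ
  ; identityʳ     = identityˡ
  }
  where open Category C

-- A k-coloring of the set presented by the setoid S: the blocks are subsets of
-- the quotient, i.e. predicates respecting the equality of S.

record Coloring {c ℓ} (S : Setoid c ℓ) (k : ℕ) : Set (c ⊔ suc ℓ) where
  open Setoid S
  field
    block    : Fin k → Pred Carrier ℓ
    respects : ∀ i → block i Respects _≈_
    covers   : Universal (⋃ (Fin k) block)
    disjoint : ∀ i j → i ≢ j → Empty (block i ∩ block j)

module Ramsey {o ℓ e} (C : Category o ℓ e) where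
  open Category C

  Invertible : ∀ {A B} → A ⇒ B → Set (ℓ ⊔ e)
  Invertible {A} {B} f = Σ (B ⇒ A) λ g → (f · g ≈ id) × (g · f ≈ id)

  infix 4 _∼_
  _∼_ : ∀ {A B} → Rel (A ⇒ B) (ℓ ⊔ e)
  _∼_ {A} f f′ = Σ (A ⇒ A) λ α → Invertible α × f′ ≈ f · α

  private
    cancelInner : ∀ {A B} {a b : A ⇒ A} (f : A ⇒ B) →
                  a · b ≈ id → (f · a) · b ≈ f
    cancelInner f p =
      ≈.trans (assoc _ _ _) (≈.trans (·-cong ≈.refl p) (identityʳ f))

    ∼-refl : ∀ {A B} {f : A ⇒ B} → f ∼ f
    ∼-refl = id , (id , identityˡ id , identityˡ id) , ≈.sym (identityʳ _)

    ∼-sym : ∀ {A B} {f g : A ⇒ B} → f ∼ g → g ∼ f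
    ∼-sym (α , (β , αβ , βα) , g≈fα) =
      β , (α , βα , αβ) ,
      ≈.sym (≈.trans (·-cong g≈fα ≈.refl) (cancelInner _ αβ))

    ∼-trans : ∀ {A B} {f g h : A ⇒ B} → f ∼ g → g ∼ h → f ∼ h
    ∼-trans (α , (α⁻ , αα⁻ , α⁻α) , g≈fα) (β , (β⁻ , ββ⁻ , β⁻β) , h≈gβ) =
      α · β , (β⁻ · α⁻ , inv αα⁻ ββ⁻ , inv β⁻β α⁻α) ,
      ≈.trans h≈gβ (≈.trans (·-cong g≈fα ≈.refl) (assoc _ _ _))
      where
      inv : ∀ {X} {a a⁻ b b⁻ : X ⇒ X} →
            a · a⁻ ≈ id → b · b⁻ ≈ id → (a · b) · (b⁻ · a⁻) ≈ id
      inv p q = ≈.trans (≈.sym (assoc _ _ _))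
                        (≈.trans (·-cong (cancelInner _ q) ≈.refl) p)

  -- The arguments are in the order of hom(A , B), so binom A B is "B choose A".

  binom : Obj → Obj → Setoid ℓ (ℓ ⊔ e)
  binom A B = record
    { Carrier       = A ⇒ B
    ; _≈_           = _∼_
    ; isEquivalence = record { refl = ∼-refl ; sym = ∼-sym ; trans = ∼-trans }
    }

  act : ∀ {A B D} → B ⇒ D → Func (binom A B) (binom A D)
  act w = record
    { to   = w ·_
    ; cong = λ (α , α-inv , g≈fα) →
        α , α-inv , ≈.trans (·-cong ≈.refl g≈fα) (≈.sym (assoc _ _ _))
    }

  RamseyProperty : Set (o ⊔ suc (ℓ ⊔ e))
  RamseyProperty =
    ∀ (k : ℕ) → 2 ≤ k → ∀ (A B : Obj) → A ⇒ B →
    Σ Obj λ D → ∀ (χ : Coloring (binom A D) k) →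
    Σ (Fin k) λ i → Σ (B ⇒ D) λ w →
    ∀ (f : Setoid.Carrier (binom A B)) → Func.to (act w) f ∈ Coloring.block χ i

open Ramsey public using (RamseyProperty)

DualRamseyProperty : ∀ {o ℓ e} → Category o ℓ e → Set (o ⊔ suc (ℓ ⊔ e))
DualRamseyProperty C = RamseyProperty (opposite C)

record FiniteDistributiveLattice : Set₁ where
  field
    distributiveLattice : DistributiveLattice 0ℓ 0ℓ
  open DistributiveLattice distributiveLattice public
  field
    𝟎 𝟏        : Carrier
    ∨-identity : Identity _≈_ 𝟎 _∨_
    ∧-identity : Identity _≈_ 𝟏 _∧_
    finite     : ∃[ n ] Inverse setoid (≡.setoid (Fin n))

record SurjectiveHom (L M : FiniteDistributiveLattice) : Set where
  private
    module L = FiniteDistributiveLattice L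
    module M = FiniteDistributiveLattice M
  field
    ⟦_⟧                   : L.Carrier → M.Carrier
    isLatticeHomomorphism : IsLatticeHomomorphism L.rawLattice M.rawLattice ⟦_⟧
    𝟎-homo                : ⟦ L.𝟎 ⟧ M.≈ M.𝟎
    𝟏-homo                : ⟦ L.𝟏 ⟧ M.≈ M.𝟏
    surjective            : Surjective L._≈_ M._≈_ ⟦_⟧
  open IsLatticeHomomorphism isLatticeHomomorphism public

D-surj : Category (suc 0ℓ) 0ℓ 0ℓ
D-surj = record
  { Obj           = FiniteDistributiveLattice
  ; _⇒_           = SurjectiveHom
  ; _≈_           = λ {L} {M} f g →
      ∀ x → FiniteDistributiveLattice._≈_ M (⟦ f ⟧ x) (⟦ g ⟧ x)
  ; id            = λ {L} → idHom L
  ; _·_           = compose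
  ; isEquivalence = λ {L} {M} → let module M = FiniteDistributiveLattice M in record
      { refl  = λ x → M.refl
      ; sym   = λ p x → M.sym (p x)
      ; trans = λ p q x → M.trans (p x) (q x)
      }
  ; ·-cong        = λ {A} {B} {C} {f} {f′} {g} {g′} p q x →
      FiniteDistributiveLattice.trans C (⟦⟧-cong f (q x)) (p (⟦ g′ ⟧ x))
  ; assoc         = λ {A} {B} {C} {D} f g h x → FiniteDistributiveLattice.refl D
  ; identityˡ     = λ {A} {B} f x → FiniteDistributiveLattice.refl B
  ; identityʳ     = λ {A} {B} f x → FiniteDistributiveLattice.refl B
  }
  where
  open SurjectiveHom

  idHom : ∀ L → SurjectiveHom L L
  idHom L = record
    { ⟦_⟧                   = Fun.id
    ; isLatticeHomomorphism = LatIdentity.isLatticeHomomorphism rawLattice refl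
    ; 𝟎-homo                = refl
    ; 𝟏-homo                = refl
    ; surjective            = Identity.surjective _≈_
    }
    where open FiniteDistributiveLattice L

  compose : ∀ {L M N} → SurjectiveHom M N → SurjectiveHom L M → SurjectiveHom L N
  compose {L} {M} {N} g f = record
    { ⟦_⟧                   = ⟦ g ⟧ Fun.∘ ⟦ f ⟧
    ; isLatticeHomomorphism = LatComposition.isLatticeHomomorphism N.trans
        (isLatticeHomomorphism f) (isLatticeHomomorphism g)
    ; 𝟎-homo                = N.trans (⟦⟧-cong g (𝟎-homo f)) (𝟎-homo g)
    ; 𝟏-homo                = N.trans (⟦⟧-cong g (𝟏-homo f)) (𝟏-homo g)
    ; surjective            =
        Composition.surjective L._≈_ M._≈_ N._≈_ (surjective f) (surjective g)
    }
    where
    module L = FiniteDistributiveLattice L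
    module M = FiniteDistributiveLattice M
    module N = FiniteDistributiveLattice N

{-# OPTIONS --safe #-}
module Submission where

-- By Birkhoff duality D-surj is dual to the category of finite posets
-- and embeddings. Dual to 𝒜 = 3 × 2 and ℬ = 3 × 3 are the posets {x < y, z} and
-- {x < y, x′ < y′} (both disjoint sums). Given any finite poset, fix a linear
-- order on its points and colour a copy of {x < y, z} by comparing x with z.
-- Every copy of {x < y, x′ < y′} contains (x < y, x′) and (x′ < y′, x), which
-- get different colours. Points are homomorphisms to the two-element chain, and
-- they are ordered lexicographically. The colouring is well defined because
-- 𝒜 has no automorphism besides the identity.

open import Defs
import Algebra.Construct.NaturalChoice.Max as Max
import Algebra.Construct.NaturalChoice.Min as Min
import Algebra.Lattice.Construct.NaturalChoice.MinMaxOp as MinMaxOp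
open import Data.Bool.Base using (if_then_else_)
open import Data.Fin.Base using (Fin; zero; suc; fromℕ; pinch)
open import Data.Fin.Patterns using (0F; 1F; 2F)
open import Data.Fin.Properties
  using (_≟_; all?; ≤-totalOrder; ≤fromℕ; pinch-surjective; *↔×)
open import Data.Nat.Base using (ℕ; zero; suc; z≤n; s≤s)
open import Data.Product.Base using (_×_; _,_; proj₁; proj₂; swap)
open import Data.Product.Function.NonDependent.Setoid using (_×-inverse_)
open import Data.Product.Relation.Binary.Pointwise.NonDependent
  using (_×ₛ_; Pointwise-≡↔≡; ×-decidable)
open import Function.Base using (_∘_)
open import Function.Bundles using (Inverse)
import Function.Construct.Composition as Composition
import Function.Construct.Identity as Identity
import Function.Construct.Symmetry as Symmetry
open import Relation.Binary.Bundles using (Setoid)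
open import Relation.Binary.Definitions using (DecidableEquality; Decidable)
open import Relation.Binary.PropositionalEquality
  using (_≡_; _≢_; _≗_; refl; sym; trans; cong)
open import Relation.Nullary using (¬_; yes; no; does; contradiction)
open import Relation.Nullary.Decidable using (_→-dec_; ¬?; _×-dec_; from-yes)

private
  module D-surj = Category D-surj

open Ramsey (opposite D-surj) using (_∼_; binom)
open SurjectiveHom

-- Chains, products and homomorphisms between them.

chain : ℕ → FiniteDistributiveLattice
chain n = record
  { distributiveLattice = ⊔-⊓-distributiveLattice
  ; 𝟎          = zero
  ; 𝟏          = fromℕ n
  ; ∨-identity = Max.⊔-identity O λ _ → z≤n
  ; ∧-identity = Min.⊓-identity O ≤fromℕ
  ; finite     = suc n , Identity.inverse _
  }
  where
  O = ≤-totalOrder (suc n)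
  open MinMaxOp (Min.minOperator O) (Max.maxOperator O)
    using (⊔-⊓-distributiveLattice)

infixr 2 _×ᴸ_ _×ʰ_

_×ᴸ_ : (L M : FiniteDistributiveLattice) → FiniteDistributiveLattice
L ×ᴸ M = record
  { distributiveLattice = record
    { _∨_ = λ (x , y) (x′ , y′) → x L.∨ x′ , y M.∨ y′
    ; _∧_ = λ (x , y) (x′ , y′) → x L.∧ x′ , y M.∧ y′
    ; isDistributiveLattice = record
      { isLattice = record
        { isEquivalence = Setoid.isEquivalence (L.setoid ×ₛ M.setoid)
        ; ∨-comm     = λ _ _ → L.∨-comm _ _ , M.∨-comm _ _
        ; ∨-assoc    = λ _ _ _ → L.∨-assoc _ _ _ , M.∨-assoc _ _ _
        ; ∨-cong     = λ (p , q) (p′ , q′) → L.∨-cong p p′ , M.∨-cong q q′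
        ; ∧-comm     = λ _ _ → L.∧-comm _ _ , M.∧-comm _ _
        ; ∧-assoc    = λ _ _ _ → L.∧-assoc _ _ _ , M.∧-assoc _ _ _
        ; ∧-cong     = λ (p , q) (p′ , q′) → L.∧-cong p p′ , M.∧-cong q q′
        ; absorptive = (λ _ _ → L.∨-absorbs-∧ _ _ , M.∨-absorbs-∧ _ _)
                     , (λ _ _ → L.∧-absorbs-∨ _ _ , M.∧-absorbs-∨ _ _)
        }
      ; ∨-distrib-∧ = (λ _ _ _ → L.∨-distribˡ-∧ _ _ _ , M.∨-distribˡ-∧ _ _ _)
                    , (λ _ _ _ → L.∨-distribʳ-∧ _ _ _ , M.∨-distribʳ-∧ _ _ _)
      ; ∧-distrib-∨ = (λ _ _ _ → L.∧-distribˡ-∨ _ _ _ , M.∧-distribˡ-∨ _ _ _)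
                    , (λ _ _ _ → L.∧-distribʳ-∨ _ _ _ , M.∧-distribʳ-∨ _ _ _)
      }
    }
  ; 𝟎          = L.𝟎 , M.𝟎
  ; 𝟏          = L.𝟏 , M.𝟏
  ; ∨-identity = (λ _ → proj₁ L.∨-identity _ , proj₁ M.∨-identity _)
               , (λ _ → proj₂ L.∨-identity _ , proj₂ M.∨-identity _)
  ; ∧-identity = (λ _ → proj₁ L.∧-identity _ , proj₁ M.∧-identity _)
               , (λ _ → proj₂ L.∧-identity _ , proj₂ M.∧-identity _)
  ; finite     = _ , Composition.inverse (proj₂ L.finite ×-inverse proj₂ M.finite)
                       (Composition.inverse Pointwise-≡↔≡ (Symmetry.inverse *↔×))
  }
  where
  module L = FiniteDistributiveLattice L
  module M = FiniteDistributiveLattice M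

_×ʰ_ : ∀ {L L′ M M′} → SurjectiveHom L L′ → SurjectiveHom M M′ →
       SurjectiveHom (L ×ᴸ M) (L′ ×ᴸ M′)
f ×ʰ g = record
  { ⟦_⟧ = λ (x , y) → ⟦ f ⟧ x , ⟦ g ⟧ y
  ; isLatticeHomomorphism = record
    { isRelHomomorphism = record { cong = λ (p , q) → ⟦⟧-cong f p , ⟦⟧-cong g q }
    ; ∧-homo = λ _ _ → ∧-homo f _ _ , ∧-homo g _ _
    ; ∨-homo = λ _ _ → ∨-homo f _ _ , ∨-homo g _ _
    }
  ; 𝟎-homo = 𝟎-homo f , 𝟎-homo g
  ; 𝟏-homo = 𝟏-homo f , 𝟏-homo g
  ; surjective = λ (x , y) →
      let (x⁻ , p) = surjective f x
          (y⁻ , q) = surjective g y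
      in (x⁻ , y⁻) , λ (r , s) → p r , q s
  }

swapʰ : ∀ L M → SurjectiveHom (L ×ᴸ M) (M ×ᴸ L)
swapʰ L M = record
  { ⟦_⟧ = swap
  ; isLatticeHomomorphism = record
    { isRelHomomorphism = record { cong = swap }
    ; ∧-homo = λ _ _ → M.refl , L.refl
    ; ∨-homo = λ _ _ → M.refl , L.refl
    }
  ; 𝟎-homo = M.refl , L.refl
  ; 𝟏-homo = M.refl , L.refl
  ; surjective = λ y → swap y , swap
  }
  where
  module L = FiniteDistributiveLattice L
  module M = FiniteDistributiveLattice M

-- The chains chain n have n + 1 elements; collapse identifies 0 and 1.
collapse : SurjectiveHom (chain 2) (chain 1)
collapse = record
  { ⟦_⟧ = pinch 0F
  ; isLatticeHomomorphism = record
    { isRelHomomorphism = record { cong = cong (pinch 0F) }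
    ; ∧-homo = from-yes (all? λ x → all? λ y → pinch 0F (x ∧ y) ≟ (pinch 0F x ∧₁ pinch 0F y))
    ; ∨-homo = from-yes (all? λ x → all? λ y → pinch 0F (x ∨ y) ≟ (pinch 0F x ∨₁ pinch 0F y))
    }
  ; 𝟎-homo = refl
  ; 𝟏-homo = refl
  ; surjective = pinch-surjective 0F
  }
  where
  open FiniteDistributiveLattice (chain 2) using (_∧_; _∨_)
  open FiniteDistributiveLattice (chain 1) using () renaming (_∧_ to _∧₁_; _∨_ to _∨₁_)

-- The two lattices and the rigidity of `𝒜`.

𝒜 ℬ : FiniteDistributiveLattice
𝒜 = chain 2 ×ᴸ chain 1
ℬ = chain 2 ×ᴸ chain 2

-- Dual to the copies (x < y, x′) and (x′ < y′, x). Of a three-element chain, `collapse` retains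
-- just the point x that `colour` reads off through `pinch 0F`.
left right : SurjectiveHom ℬ 𝒜
left  = D-surj.id {chain 2} ×ʰ collapse
right = left D-surj.· swapʰ (chain 2) (chain 2)

module 𝒜 = FiniteDistributiveLattice 𝒜

infix 4 _≈?_

_≈?_ : Decidable 𝒜._≈_
_≈?_ = ×-decidable _≟_ _≟_

-- The hypotheses hold for a = (1 , 0), b = (2 , 0), c = (0 , 1), the
-- join-irreducible elements of 𝒜, and are preserved by automorphisms.
joinIrreducibles-unique : ∀ a₁ a₂ b₁ b₂ c₁ c₂ →
  let a = a₁ , a₂ ; b = b₁ , b₂ ; c = c₁ , c₂ in
  a 𝒜.∧ b 𝒜.≈ a → b 𝒜.∧ c 𝒜.≈ 𝒜.𝟎 → b 𝒜.∨ c 𝒜.≈ 𝒜.𝟏 →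
  ¬ a 𝒜.≈ 𝒜.𝟎 → ¬ a 𝒜.≈ b → ¬ c 𝒜.≈ 𝒜.𝟎 →
  a 𝒜.≈ (1F , 0F) × b 𝒜.≈ (2F , 0F) × c 𝒜.≈ (0F , 1F)
joinIrreducibles-unique = from-yes
  (all? λ a₁ → all? λ a₂ → all? λ b₁ → all? λ b₂ → all? λ c₁ → all? λ c₂ →
   let a = a₁ , a₂ ; b = b₁ , b₂ ; c = c₁ , c₂ in
   (a 𝒜.∧ b ≈? a) →-dec (b 𝒜.∧ c ≈? 𝒜.𝟎) →-dec (b 𝒜.∨ c ≈? 𝒜.𝟏) →-dec
   ¬? (a ≈? 𝒜.𝟎) →-dec ¬? (a ≈? b) →-dec ¬? (c ≈? 𝒜.𝟎) →-dec
   ((a ≈? (1F , 0F)) ×-dec (b ≈? (2F , 0F)) ×-dec (c ≈? (0F , 1F))))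

-- The images of the join-irreducible elements satisfy the same relations, so `α` fixes these
-- elements, and every element is a join of them.
rigid : (α : SurjectiveHom 𝒜 𝒜) →
        (∀ {x y} → ⟦ α ⟧ x 𝒜.≈ ⟦ α ⟧ y → x 𝒜.≈ y) → ∀ x → ⟦ α ⟧ x 𝒜.≈ x
rigid α injective = fixed
  where
  irreducibles-fixed =
    joinIrreducibles-unique _ _ _ _ _ _
      (𝒜.sym (∧-homo α (1F , 0F) (2F , 0F)))
      (𝒜.trans (𝒜.sym (∧-homo α (2F , 0F) (0F , 1F))) (𝟎-homo α))
      (𝒜.trans (𝒜.sym (∨-homo α (2F , 0F) (0F , 1F))) (𝟏-homo α))
      -- Pulled back along the injective `α`, each excluded equation fails in one coordinate.
      (λ p → contradiction (proj₁ (injective (𝒜.trans p (𝒜.sym (𝟎-homo α))))) λ ())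
      (λ p → contradiction (proj₁ (injective p)) λ ())
      (λ p → contradiction (proj₂ (injective (𝒜.trans p (𝒜.sym (𝟎-homo α))))) λ ())

  a-fixed = proj₁ irreducibles-fixed
  b-fixed = proj₁ (proj₂ irreducibles-fixed)
  c-fixed = proj₂ (proj₂ irreducibles-fixed)

  fixed : ∀ x → ⟦ α ⟧ x 𝒜.≈ x
  fixed (0F , 0F) = 𝟎-homo α
  fixed (1F , 0F) = a-fixed
  fixed (2F , 0F) = b-fixed
  fixed (0F , 1F) = c-fixed
  fixed (1F , 1F) = 𝒜.trans (∨-homo α (1F , 0F) (0F , 1F)) (𝒜.∨-cong a-fixed c-fixed)
  fixed (2F , 1F) = 𝟏-homo α

-- Lexicographic comparison of tuples.

module _ {X : Set} (_≟ˣ_ : DecidableEquality X) (default : X) where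

  -- The value u takes at the least argument where it differs from v.
  atFirstDifference : ∀ {n} → (Fin n → X) → (Fin n → X) → X
  atFirstDifference {zero}  u v = default
  atFirstDifference {suc n} u v =
    if does (u zero ≟ˣ v zero) then atFirstDifference (u ∘ suc) (v ∘ suc) else u zero

  atFirstDifference-cong : ∀ {n} {u u′ v v′ : Fin n → X} → u ≗ u′ → v ≗ v′ →
                           atFirstDifference u v ≡ atFirstDifference u′ v′
  atFirstDifference-cong {zero}  p q = refl
  atFirstDifference-cong {suc n} p q
    rewrite p zero | q zero
          | atFirstDifference-cong (p ∘ suc) (q ∘ suc) = refl

  -- Both sides stop at the same least argument, one with the entry of `u`, the other with that of
  -- `v`. The index `i` guarantees that the search does not end in `default`.
  atFirstDifference-asym : ∀ {n} {u v : Fin n → X} i → u i ≢ v i →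
                           atFirstDifference u v ≢ atFirstDifference v u
  atFirstDifference-asym {suc n} {u} {v} i uᵢ≢vᵢ
    with u zero ≟ˣ v zero | v zero ≟ˣ u zero
  -- The two sides test the equation in opposite directions, so mixed answers have to be refuted.
  ... | yes p | no ¬q = contradiction (sym p) ¬q
  ... | no ¬p | yes q = contradiction (sym q) ¬p
  ... | no ¬p | no _  = ¬p
  atFirstDifference-asym {suc n} zero    u₀≢v₀ | yes p | yes _ = contradiction p u₀≢v₀
  atFirstDifference-asym {suc n} (suc i) uᵢ≢vᵢ | yes _ | yes _ =
    atFirstDifference-asym i uᵢ≢vᵢ

-- The colouring of the copies of `𝒜`.

module _ (D : FiniteDistributiveLattice) where

  private
    module D = FiniteDistributiveLattice D
    open Inverse (proj₂ D.finite) using (to; from; strictlyInverseʳ)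

  -- The points x and z of the copy `f`, in this order, are written as bit tuples along the
  -- enumeration of `D`. The bit of x at the first difference is 1 exactly when x is
  -- lexicographically larger than z.
  colour : SurjectiveHom D 𝒜 → Fin 2
  colour f = atFirstDifference _≟_ 0F
    (pinch 0F ∘ proj₁ ∘ ⟦ f ⟧ ∘ from) (proj₂ ∘ ⟦ f ⟧ ∘ from)

  colour-cong : ∀ f g → (∀ x → ⟦ f ⟧ x 𝒜.≈ ⟦ g ⟧ x) → colour f ≡ colour g
  colour-cong f g p = atFirstDifference-cong _≟_ 0F
    (λ i → cong (pinch 0F) (proj₁ (p (from i)))) (λ i → proj₂ (p (from i)))

  -- In the opposite category `f ∼ g` means that g is f followed by an automorphism of `𝒜`, which is
  -- the identity by `rigid`.
  colour-invariant : ∀ f g → f ∼ g → colour f ≡ colour g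
  colour-invariant f g (α , (β , β∘α≈id , _) , g≈α∘f) = colour-cong f g λ x →
    𝒜.sym (𝒜.trans (g≈α∘f x) (rigid α α-injective (⟦ f ⟧ x)))
    where
    α-injective : ∀ {x y} → ⟦ α ⟧ x 𝒜.≈ ⟦ α ⟧ y → x 𝒜.≈ y
    α-injective {x} {y} p =
      𝒜.trans (𝒜.sym (β∘α≈id x)) (𝒜.trans (⟦⟧-cong β p) (β∘α≈id y))

  colouring : Coloring (binom 𝒜 D) 2
  colouring = record
    { block    = λ i f → colour f ≡ i
    ; respects = λ i {f} {g} f∼g p → trans (sym (colour-invariant f g f∼g)) p
    ; covers   = λ f → colour f , refl
    ; disjoint = λ i j i≢j f (p , q) → i≢j (trans (sym p) q)
    }

  -- Both colours compare the same two tuples, with the roles of x and z exchanged.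
  colour-left≢right : ∀ w → colour (left D-surj.· w) ≢ colour (right D-surj.· w)
  colour-left≢right w with surjective w (0F , 2F)
  ... | x , p = atFirstDifference-asym _≟_ 0F (to x) differ
    where
    wx≈ = p (strictlyInverseʳ x)
    differ : pinch 0F (proj₁ (⟦ w ⟧ (from (to x)))) ≢ pinch 0F (proj₂ (⟦ w ⟧ (from (to x))))
    differ rewrite proj₁ wx≈ | proj₂ wx≈ = λ ()

theorem3p1 : ¬ DualRamseyProperty D-surj
theorem3p1 ramsey with ramsey 2 (s≤s (s≤s z≤n)) 𝒜 ℬ left
... | D , homogeneous with homogeneous (colouring D)
... | _ , w , monochromatic =
  colour-left≢right D w (trans (monochromatic left) (sym (monochromatic right)))
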